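{- Let $\dagger : \mathbb{G}(P)\times \mathcal{L}_0(P) \rightarrow \mathbb{G}(P)$ be a relevant P-graph transformation. Suppose that for every P-graph $G = \langle \Phi, \prec\rangle$ and every propositional formula $\varphi \in \mathcal{L}_0(P)$, the P-graph $\dagger(G,\varphi)= \langle \Phi_\dagger, \prec_\dagger\rangle$ satisfies the following condition: for all $\xi \in \Phi_\dagger$, either $\xi \equiv \varphi$, or there is some $\xi' \in \Phi$ such that (a) $\varphi \wedge \xi' \vdash \xi$, (b) $\neg\varphi \wedge \xi \vdash \xi'$, and (c) for all $\psi' \in \Phi$, if $\psi' \prec \xi'$ then there is $\psi \in \Phi_\dagger$ such that $\varphi \wedge \psi' \vdash \psi$, $\neg\varphi \wedge \psi \vdash \psi'$ and $\psi\prec_\dagger \xi$. Then $\dagger$ satisfies DP-4; that is, for every dynamic operator $\star$ induced by $\dagger$, every preference model $M=\langle W,\leq,v\rangle$ that is induced by some P-graph, every $\varphi\in\mathcal{L}_0(P)$, writing $\star(M,\varphi)=\langle W,\leq_{\star\varphi},v\rangle$, and all $w,w'\in W$ with $w\vDash\varphi$ and $w'\not\vDash\varphi$: if $w\leq w'$ then $w\leq_{\star\varphi} w'$.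
   Context: $P$ is a countable set of propositional symbols and $\mathcal{L}_0(P)$ is the set of classical propositional formulas over $P$; $\equiv$ is classical logical equivalence and $\vdash$ is classical entailment. P-graph: a pair $G=\langle\Phi,\prec\rangle$ with $\Phi\subseteq\mathcal{L}_0(P)$ and $\prec$ a strict partial order on $\Phi$. $\mathbb{G}(P)$ is the set of all P-graphs over $P$. Given a non-empty set $W$ of worlds and a valuation $v:P\to 2^W$, $w\vDash\varphi$ denotes classical satisfaction of $\varphi$ at $w$ (with $w\vDash p$ iff $w\in v(p)$). The relation $\leq_G$ on $W$ is: $w\leq_G w'$ iff for every $\varphi\in\Phi$, either ($w'\vDash\varphi$ implies $w\vDash\varphi$), or there is $\psi\in\Phi$ with $\psi\prec\varphi$, $w\vDash\psi$ and $w'\not\vDash\psi$. Preference model: $M=\langle W,\leq,v\rangle$ with $W$ a non-empty set, $v:P\to 2^W$, and $\leq$ a reflexive transitive relation on $W$ whose strict part $<$ ($w<w'$ iff $w\leq w'$ and not $w'\leq w$) is well-founded. $M$ is induced by a P-graph $G$ iff $\leq\;=\;\leq_G$ (computed with $W$ and $v$). Dynamic operator: a function $\star$ mapping each pair (preference model $\langle W,\leq,v\rangle$, formula $\varphi\in\mathcal{L}_0(P)$) to a preference model $\langle W,\leq_{\star\varphi},v\rangle$ with the same $W$ and $v$. P-graph transformation: any function $\dagger:\mathbb{G}(P)\times\mathcal{L}_0(P)\to\mathbb{G}(P)$. A dynamic operator $\star$ is induced by $\dagger$ if for all preference models $M$, P-graphs $G$ and formulas $\varphi\in\mathcal{L}_0(P)$: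 if $M$ is induced by $G$ then $\star(M,\varphi)$ is induced by $\dagger(G,\varphi)$. $\dagger$ is relevant if some dynamic operator is induced by it. -}

module Defs where

open import Level using (0ℓ)
open import Data.Bool.Base as Bool using (Bool; true; false; T)
open import Data.Product.Base using (_×_; ∃; ∃-syntax)
open import Data.Sum.Base using (_⊎_)
open import Function.Bundles using (_↣_)
open import Data.Nat.Base using (ℕ)
open import Induction.WellFounded using (WellFounded)
open import Relation.Binary.Core using (Rel; _⇔_)
open import Relation.Binary.PropositionalEquality.Core using (_≡_)
open import Relation.Binary.Structures using (IsPreorder; IsStrictPartialOrder)
open import Relation.Nullary.Negation.Core using (¬_)
open import Relation.Unary using (Pred; _∈_; _≐_)

-- Finite sets are included.
Countable : Set → Set
Countable P = P ↣ ℕ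

infix  9 ~_
infixr 8 _∧_
infixr 7 _∨_
infixr 6 _⊃_

data Formula (P : Set) : Set where
  var         : P → Formula P
  tt ff       : Formula P
  ~_          : Formula P → Formula P
  _∧_ _∨_ _⊃_ : Formula P → Formula P → Formula P

Assignment : Set → Set
Assignment P = P → Bool

eval : {P : Set} → Assignment P → Formula P → Bool
eval α (var p) = α p
eval α tt      = true
eval α ff      = false
eval α (~ φ)   = Bool.not (eval α φ)
eval α (φ ∧ ψ) = eval α φ Bool.∧ eval α ψ
eval α (φ ∨ ψ) = eval α φ Bool.∨ eval α ψ
eval α (φ ⊃ ψ) = Bool.not (eval α φ) Bool.∨ eval α ψ

infix 4 _⊢_ _≡ₗ_

_⊢_ : {P : Set} → Formula P → Formula P → Set
φ ⊢ ψ = ∀ α → T (eval α φ) → T (eval α ψ)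

_≡ₗ_ : {P : Set} → Formula P → Formula P → Set
φ ≡ₗ ψ = ∀ α → eval α φ ≡ eval α ψ

-- 2^W is read as W → Bool, so that satisfaction at a world is two-valued.
Valuation : Set → Set → Set
Valuation P W = P → W → Bool

infix 4 _∣_⊨_

_∣_⊨_ : {P W : Set} → Valuation P W → W → Formula P → Set
v ∣ w ⊨ φ = T (eval (λ p → v p w) φ)

-- The order on Φ is a relation on all formulas contained in Φ × Φ; for such a
-- relation the strict partial order axioms on Φ and on all formulas coincide.
record PGraph (P : Set) : Set₁ where
  infix 4 _≺_
  field
    Φ                    : Pred (Formula P) 0ℓ
    _≺_                  : Rel (Formula P) 0ℓ
    ≺⊆Φ×Φ                : ∀ {φ ψ} → φ ≺ ψ → φ ∈ Φ × ψ ∈ Φ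
    isStrictPartialOrder : IsStrictPartialOrder _≡_ _≺_

graphOrder : {P W : Set} → PGraph P → Valuation P W → Rel W 0ℓ
graphOrder G v w w′ = ∀ φ → φ ∈ Φ →
  (v ∣ w′ ⊨ φ → v ∣ w ⊨ φ) ⊎
  (∃[ ψ ] ψ ∈ Φ × ψ ≺ φ × (v ∣ w ⊨ ψ) × ¬ (v ∣ w′ ⊨ ψ))
  where open PGraph G

StrictPart : {W : Set} → Rel W 0ℓ → Rel W 0ℓ
StrictPart _≤_ w w′ = w ≤ w′ × ¬ (w′ ≤ w)

record IsPreference {W : Set} (_≤_ : Rel W 0ℓ) : Set where
  field
    isPreorder    : IsPreorder _≡_ _≤_
    <-wellFounded : WellFounded (StrictPart _≤_)

record PreferenceModel (P W : Set) : Set₁ where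
  infix 4 _≤_
  field
    nonempty     : W
    v            : Valuation P W
    _≤_          : Rel W 0ℓ
    isPreference : IsPreference _≤_

InducedBy : {P W : Set} → PreferenceModel P W → PGraph P → Set
InducedBy M G = _≤_ ⇔ graphOrder G v
  where open PreferenceModel M

-- Set-theoretic equality of P-graphs and of models on the same W: the proof
-- components, and the chosen element of W, are ignored.
infix 4 _≈ᴳ_ _≈ᴹ_

_≈ᴳ_ : {P : Set} → Rel (PGraph P) 0ℓ
G ≈ᴳ G′ = (Φ G ≐ Φ G′) × (_≺_ G ⇔ _≺_ G′)
  where open PGraph

_≈ᴹ_ : {P W : Set} → Rel (PreferenceModel P W) 0ℓ
M ≈ᴹ M′ = (∀ p w → v M p w ≡ v M′ p w) × (_≤_ M ⇔ _≤_ M′)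
  where open PreferenceModel

-- Only the new order is data, since W and v do not change.
record DynamicOperator (P : Set) : Set₁ where
  field
    newOrder     : {W : Set} → PreferenceModel P W → Formula P → Rel W 0ℓ
    isPreference : ∀ {W} (M : PreferenceModel P W) φ → IsPreference (newOrder M φ)
    cong         : ∀ {W} {M M′ : PreferenceModel P W} φ →
                   M ≈ᴹ M′ → newOrder M φ ⇔ newOrder M′ φ

  apply : {W : Set} → PreferenceModel P W → Formula P → PreferenceModel P W
  apply M φ = record
    { nonempty     = PreferenceModel.nonempty M
    ; v            = PreferenceModel.v M
    ; _≤_          = newOrder M φ
    ; isPreference = isPreference M φ
    }

record PGraphTransformation (P : Set) : Set₁ where
  field
    apply : PGraph P → Formula P → PGraph P
    cong  : ∀ {G G′} φ → G ≈ᴳ G′ → apply G φ ≈ᴳ apply G′ φ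

OperatorInducedBy : {P : Set} → DynamicOperator P → PGraphTransformation P → Set₁
OperatorInducedBy {P} ★ † =
  ∀ {W} (M : PreferenceModel P W) (G : PGraph P) (φ : Formula P) →
  InducedBy M G →
  InducedBy (DynamicOperator.apply ★ M φ) (PGraphTransformation.apply † G φ)

Relevant : {P : Set} → PGraphTransformation P → Set₁
Relevant † = ∃ λ ★ → OperatorInducedBy ★ †

DP-4 : {P : Set} → PGraphTransformation P → Set₁
DP-4 {P} † =
  ∀ (★ : DynamicOperator P) → OperatorInducedBy ★ † →
  ∀ {W} (M : PreferenceModel P W) → (∃[ G ] InducedBy M G) →
  let open PreferenceModel M
      _≤★[_]_ = λ w φ w′ → PreferenceModel._≤_ (DynamicOperator.apply ★ M φ) w w′
  in
  ∀ (φ : Formula P) (w w′ : W) →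
  v ∣ w ⊨ φ → ¬ (v ∣ w′ ⊨ φ) →
  w ≤ w′ → w ≤★[ φ ] w′

{-# OPTIONS --safe #-}
module Submission where

open import Defs
open import Data.Bool.Base using (true; false; T)
open import Data.Bool.Properties using (T-∧)
open import Data.Empty using (⊥-elim)
open import Data.Product.Base using (_×_; ∃-syntax; _,_; proj₁; proj₂)
open import Data.Sum.Base using (_⊎_; inj₁; inj₂)
open import Data.Unit.Base using (tt)
open import Function.Base using (_∘_)
open import Function.Bundles using (Equivalence)
open import Relation.Binary.PropositionalEquality using (subst; sym)
open import Relation.Nullary.Negation.Core using (¬_)
open import Relation.Unary using (_∈_)

-- Both the old and the new order are graph orders, so each `ξ` in the new graph can be checked
-- separately. As `w` satisfies `φ` and `w′` does not, the side premises `φ` and `~ φ` of the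
-- entailments are discharged: truth passes from old formulas to their new counterparts at `w`, and
-- from new to old at `w′`. So whichever disjunct justifies `w ≤ w′` at `ξ′` carries over to `ξ`.

module _ {P W : Set} (v : Valuation P W) where

  ⊨-~ : ∀ {w} φ → ¬ (v ∣ w ⊨ φ) → v ∣ w ⊨ ~ φ
  ⊨-~ {w} φ w⊭φ with eval (λ p → v p w) φ
  ... | true  = ⊥-elim (w⊭φ tt)
  ... | false = tt

  ⊨-∧-⊢ : ∀ {w} φ ψ χ → φ ∧ ψ ⊢ χ → v ∣ w ⊨ φ → v ∣ w ⊨ ψ → v ∣ w ⊨ χ
  ⊨-∧-⊢ _ _ _ φψ⊢χ w⊨φ w⊨ψ = φψ⊢χ _ (Equivalence.from T-∧ (w⊨φ , w⊨ψ))

proposition14 : (P : Set) → Countable P →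
    († : PGraphTransformation P) → Relevant † →
    (∀ (G : PGraph P) (φ : Formula P) →
      let open PGraph G
          Φ† = PGraph.Φ (PGraphTransformation.apply † G φ)
          _≺†_ = PGraph._≺_ (PGraphTransformation.apply † G φ)
      in
      ∀ ξ → ξ ∈ Φ† →
        (ξ ≡ₗ φ) ⊎
        (∃[ ξ′ ] (ξ′ ∈ Φ) ×
          (φ ∧ ξ′ ⊢ ξ) ×
          (~ φ ∧ ξ ⊢ ξ′) ×
          (∀ ψ′ → ψ′ ∈ Φ → ψ′ ≺ ξ′ →
            ∃[ ψ ] (ψ ∈ Φ†) ×
              (φ ∧ ψ′ ⊢ ψ) × (~ φ ∧ ψ ⊢ ψ′) × (ψ ≺† ξ)))) →
    DP-4 †
proposition14 P _ † _ condition ★ ★-induced M (G , M-induced) φ w w′ w⊨φ w′⊭φ w≤w′ =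
  proj₂ (★-induced M G φ M-induced) w≤†w′
  where
  open PreferenceModel M using (v)

  at-w : ∀ χ ξ → φ ∧ χ ⊢ ξ → v ∣ w ⊨ χ → v ∣ w ⊨ ξ
  at-w χ ξ φχ⊢ξ = ⊨-∧-⊢ v φ χ ξ φχ⊢ξ w⊨φ

  at-w′ : ∀ ξ χ → ~ φ ∧ ξ ⊢ χ → v ∣ w′ ⊨ ξ → v ∣ w′ ⊨ χ
  at-w′ ξ χ ~φξ⊢χ = ⊨-∧-⊢ v (~ φ) ξ χ ~φξ⊢χ (⊨-~ v φ w′⊭φ)

  w≤†w′ : graphOrder (PGraphTransformation.apply † G φ) v w w′
  w≤†w′ ξ ξ∈Φ† with condition G φ ξ ξ∈Φ†
  -- `ξ` holds at `w` outright, whatever its value at `w′`.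
  ... | inj₁ ξ≡φ = inj₁ λ _ → subst T (sym (ξ≡φ _)) w⊨φ
  ... | inj₂ (ξ′ , ξ′∈Φ , a , b , c) with proj₁ M-induced w≤w′ ξ′ ξ′∈Φ
  -- Detour through the old graph: from `ξ` to `ξ′` at `w′` by (b), across to `w`, then back to `ξ`
  -- by (a).
  ...   | inj₁ ξ′-preserved = inj₁ (at-w ξ′ ξ a ∘ ξ′-preserved ∘ at-w′ ξ ξ′ b)
  ...   | inj₂ (ψ′ , ψ′∈Φ , ψ′≺ξ′ , w⊨ψ′ , w′⊭ψ′) with c ψ′ ψ′∈Φ ψ′≺ξ′
  ...     | ψ , ψ∈Φ† , φψ′⊢ψ , ~φψ⊢ψ′ , ψ≺†ξ =
    -- The counterpart `ψ` of the old witness `ψ′` still separates the worlds: it inherits truth at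
    -- `w`, and if it held at `w′`, so would `ψ′`.
    inj₂ (ψ , ψ∈Φ† , ψ≺†ξ , at-w ψ′ ψ φψ′⊢ψ w⊨ψ′ , w′⊭ψ′ ∘ at-w′ ψ ψ′ ~φψ⊢ψ′)
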